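{- There exists a function $\rho$ from the set of all (finite) instruction sequences to the set of closed terms of BTA extended with explicit substitution such that for every instruction sequence $P$: $\mathrm{elim}(\rho(P))$ is identical to $|P|$, and $\mathrm{size}(\rho(P))\le 4\cdot\mathrm{len}(P)+1$.
   Context: Fix a set of basic instructions (actions). A primitive instruction is one of: $a$, $+a$, $-a$ (for a basic instruction $a$), $\#l$ ($l\in\mathbb N$), or $!$. An instruction sequence is a finite nonempty sequence $P=u_1;\dots;u_k$ of primitive instructions; $\mathrm{len}(P)=k$. Terms of BTA with explicit substitution: fix a countably infinite set of variables; terms are variables $x$, the constants $S$ (termination) and $D$ (deadlock), postconditional compositions $p\trianglelefteq a\trianglerighteq q$ for terms $p,q$ and basic instruction $a$, and substitutions $[p/x]q$ for terms $p,q$ and variable $x$. Write $a\circ p$ for $p\trianglelefteq a\trianglerighteq p$. A term is closed if it has no variable occurrences outside the bound position of substitution... more precisely, closed means $\mathrm{elim}$ of it contains no variables. Size: $\mathrm{size}(x)=\mathrm{size}(S)=\mathrm{size}(D)=1$, $\mathrm{size}(p\trianglelefteq a\trianglerighteq q)=\mathrm{size}(p)+\mathrm{size}(q)+1$, $\mathrm{size}([p/x]q)=\mathrm{size}(p)+\mathrm{size}(q)+1$. Substitution elimination $\mathrm{elim}$: $\mathrm{elim}(x)=x$, $\mathrm{elim}(S)=S$, $\mathrm{elim}(D)=D$, $\mathrm{elim}(p\trianglelefteq a\trianglerighteq q)=\mathrm{elim}(p)\trianglelefteq a\trianglerighteq\mathrm{elim}(q)$, and $\mathrm{elim}([p/x]q)$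 is obtained from $\mathrm{elim}(q)$ by replacing every occurrence of $x$ by $\mathrm{elim}(p)$ (this corresponds to the axioms $[p/x]x=p$, $[p/x]y=y$ for $y\ne x$, $[p/x]S=S$, $[p/x]D=D$, $[p/x](q\trianglelefteq a\trianglerighteq r)=([p/x]q)\trianglelefteq a\trianglerighteq([p/x]r)$). Thread extraction $|\cdot|$ maps instruction sequences to substitution-free closed terms by: $|a|=a\circ D$; $|a;Y|=a\circ|Y|$; $|+a|=a\circ D$; $|+a;Y|=|Y|\trianglelefteq a\trianglerighteq|\#2;Y|$; $|-a|=a\circ D$; $|-a;Y|=|\#2;Y|\trianglelefteq a\trianglerighteq|Y|$; $|\#l|=D$; $|\#0;Y|=D$; $|\#1;Y|=|Y|$; $|\#(l+2);u|=D$ for a primitive instruction $u$; $|\#(l+2);u;Y|=|\#(l+1);Y|$; $|!|=S$; $|!;Y|=S$. -}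

module Defs where

open import Data.Bool.Base using (if_then_else_)
open import Data.List.Base using (List; []; _∷_)
open import Data.List.NonEmpty.Base using (List⁺; _∷_)
open import Data.Nat.Base using (ℕ; zero; suc; _+_)
open import Data.Nat.Properties using (_≟_)
open import Data.Product.Base using (Σ)
open import Level using (Level)
open import Relation.Binary.PropositionalEquality using (_≡_; refl)
open import Relation.Nullary using (¬_; does)

private
  variable
    ℓ : Level
    A : Set ℓ

infix 9 +_ -_ #_

data Instr (A : Set ℓ) : Set ℓ where
  basic : A → Instr A
  +_    : A → Instr A
  -_    : A → Instr A
  #_    : ℕ → Instr A
  !     : Instr A

InstrSeq : Set ℓ → Set ℓ
InstrSeq A = List⁺ (Instr A)

Var : Set
Var = ℕ

infix 6 _⊴_⊵_ _∘_
infix 7 [_/_]_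

-- Substitution-free terms.  They form a type of their own so that the
-- codomains of elim and of thread extraction are substitution-free by typing.
data BTA (A : Set ℓ) : Set ℓ where
  var   : Var → BTA A
  S D   : BTA A
  _⊴_⊵_ : BTA A → A → BTA A → BTA A

data Term (A : Set ℓ) : Set ℓ where
  var    : Var → Term A
  S D    : Term A
  _⊴_⊵_  : Term A → A → Term A → Term A
  [_/_]_ : Term A → Var → Term A → Term A

_∘_ : A → BTA A → BTA A
a ∘ p = p ⊴ a ⊵ p

size : Term A → ℕ
size (var x)       = 1
size S             = 1
size D             = 1
size (p ⊴ a ⊵ q)   = size p + size q + 1
size ([ p / x ] q) = size p + size q + 1

-- replace p x q is q with every occurrence of x replaced by p.
replace : BTA A → Var → BTA A → BTA A
replace p x (var y)     = if does (x ≟ y) then p else var y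
replace p x S           = S
replace p x D           = D
replace p x (q ⊴ a ⊵ r) = replace p x q ⊴ a ⊵ replace p x r

elim : Term A → BTA A
elim (var x)       = var x
elim S             = S
elim D             = D
elim (p ⊴ a ⊵ q)   = elim p ⊴ a ⊵ elim q
elim ([ p / x ] q) = replace (elim p) x (elim q)

data _occursIn_ {A : Set ℓ} (x : Var) : BTA A → Set ℓ where
  here  : x occursIn var x
  left  : ∀ {p a q} → x occursIn p → x occursIn (p ⊴ a ⊵ q)
  right : ∀ {p a q} → x occursIn q → x occursIn (p ⊴ a ⊵ q)

Closed : {A : Set ℓ} → Term A → Set ℓ
Closed t = ∀ x → ¬ (x occursIn elim t)

ClosedTerm : Set ℓ → Set ℓ
ClosedTerm A = Σ (Term A) Closed

-- extract u us is |u;us|, and jump l v vs is |#l;v;vs|.  The jump clauses are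
-- split off because |+a;Y| refers to |#2;Y|, which is as long as +a;Y, so that
-- the defining equations read as one function are not structurally recursive.
mutual
  extract : Instr A → List (Instr A) → BTA A
  extract (basic a) []       = a ∘ D
  extract (basic a) (v ∷ vs) = a ∘ extract v vs
  extract (+ a)     []       = a ∘ D
  extract (+ a)     (v ∷ vs) = extract v vs ⊴ a ⊵ jump 2 v vs
  extract (- a)     []       = a ∘ D
  extract (- a)     (v ∷ vs) = jump 2 v vs ⊴ a ⊵ extract v vs
  extract (# l)     []       = D
  extract (# l)     (v ∷ vs) = jump l v vs
  extract !         _        = S

  jump : ℕ → Instr A → List (Instr A) → BTA A
  jump zero          v vs       = D
  jump (suc zero)    v vs       = extract v vs
  jump (suc (suc l)) v []       = D
  jump (suc (suc l)) v (w ∷ ws) = jump (suc l) w ws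

∣_∣ : InstrSeq A → BTA A
∣ u ∷ us ∣ = extract u us

-- The equations that pass through jump, in their original form.
module _ {A : Set ℓ} (a : A) (l : ℕ) (u v : Instr A) (us vs : List (Instr A)) where

  extract-+ : ∣ + a ∷ u ∷ us ∣ ≡ ∣ u ∷ us ∣ ⊴ a ⊵ ∣ # 2 ∷ u ∷ us ∣
  extract-+ = refl

  extract-- : ∣ - a ∷ u ∷ us ∣ ≡ ∣ # 2 ∷ u ∷ us ∣ ⊴ a ⊵ ∣ u ∷ us ∣
  extract-- = refl

  extract-#0 : ∣ # 0 ∷ u ∷ us ∣ ≡ D
  extract-#0 = refl

  extract-#1 : ∣ # 1 ∷ u ∷ us ∣ ≡ ∣ u ∷ us ∣
  extract-#1 = refl

  extract-#2+-end : ∣ # (suc (suc l)) ∷ u ∷ [] ∣ ≡ D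
  extract-#2+-end = refl

  extract-#2+ : ∣ # (suc (suc l)) ∷ u ∷ v ∷ vs ∣ ≡ ∣ # (suc l) ∷ v ∷ vs ∣
  extract-#2+ = refl

{-# OPTIONS --safe #-}
-- Use the variable with number n for the thread of the suffix of length n.
-- Then each instruction contributes a single term over the variables of later
-- suffixes, of size at most 3, and binding it to its own variable costs one
-- more.  Substituting for the first instruction innermost and for the last one
-- outermost resolves the references to later suffixes without copying them.
module Submission where

open import Data.List.NonEmpty using (length)
open import Data.Nat using (_+_; _*_; _≤_)
open import Data.Product using (Σ; _×_; proj₁)
open import Level using (Level)
open import Relation.Binary.PropositionalEquality using (_≡_)
open import Defs using (InstrSeq; ClosedTerm; elim; size; ∣_∣)

open import Data.List.Base as List using (List; []; _∷_)
open import Data.List.NonEmpty using (_∷_)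
open import Data.Nat using (ℕ; zero; suc; _<_; z≤n; s≤s)
open import Data.Nat.Properties
  using (_≟_; ≤-refl; ≤-reflexive; <-trans; n<1+n; >⇒≢; +-monoˡ-≤; +-monoʳ-≤; module ≤-Reasoning)
open import Data.Nat.Solver using (module +-*-Solver)
open import Data.Product using (_,_)
open import Relation.Binary.PropositionalEquality
  using (refl; sym; trans; cong; cong₂; subst; module ≡-Reasoning)
open import Relation.Nullary using (¬_)
open import Relation.Nullary.Decidable using (dec-true; dec-false)
open import Data.Bool.Base using (if_then_else_)
open import Defs

private
  variable
    ℓ : Level
    A : Set ℓ

replace-≡ : (p : BTA A) (x : Var) → replace p x (var x) ≡ p
replace-≡ p x = cong (if_then p else var x) (dec-true (x ≟ x) refl)

replace-≢ : (p : BTA A) {x y : Var} → ¬ x ≡ y → replace p x (var y) ≡ var y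
replace-≢ p {x} {y} x≢y = cong (if_then p else var y) (dec-false (x ≟ y) x≢y)

-- The reference made by a jump #l that is followed by us.
target : ℕ → List (Instr A) → Term A
target zero          us       = D
target (suc l)       []       = D
target (suc zero)    (u ∷ us) = var (suc (List.length us))
target (suc (suc l)) (u ∷ us) = target (suc l) us

-- Falling through counts as a jump by 1 and skipping as a jump by 2. An instruction with nothing
-- after it is covered too, since `target` yields `D` past the end.
node : Instr A → List (Instr A) → Term A
node (basic a) us = target 1 us ⊴ a ⊵ target 1 us
node (+ a)     us = target 1 us ⊴ a ⊵ target 2 us
node (- a)     us = target 2 us ⊴ a ⊵ target 1 us
node (# l)     us = target l us
node !         us = S

bind : List (Instr A) → Term A → Term A
bind []       q = q
bind (u ∷ us) q = bind us ([ node u us / suc (List.length us) ] q)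

-- The replacements that `elim` carries out on a term wrapped by `bind`, performed directly on `BTA`
-- terms, where their composite distributes over postconditional composition.
resolve : List (Instr A) → BTA A → BTA A
resolve []       p = p
resolve (u ∷ us) p = resolve us (replace (elim (node u us)) (suc (List.length us)) p)

elim-bind : (us : List (Instr A)) (q : Term A) → elim (bind us q) ≡ resolve us (elim q)
elim-bind []       q = refl
elim-bind (u ∷ us) q = elim-bind us _

resolve-S : (us : List (Instr A)) → resolve us S ≡ S
resolve-S []       = refl
resolve-S (u ∷ us) = resolve-S us

resolve-D : (us : List (Instr A)) → resolve us D ≡ D
resolve-D []       = refl
resolve-D (u ∷ us) = resolve-D us

resolve-⊴⊵ : (us : List (Instr A)) (p : BTA A) (a : A) (q : BTA A) →
  resolve us (p ⊴ a ⊵ q) ≡ resolve us p ⊴ a ⊵ resolve us q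
resolve-⊴⊵ []       p a q = refl
resolve-⊴⊵ (u ∷ us) p a q = resolve-⊴⊵ us _ a _

-- A reference into `us` is `D` or a variable numbered at most the length of `us`, so replacing a
-- variable with a larger number leaves it alone.
replace-target : (p : BTA A) (l : ℕ) (us : List (Instr A)) {n : ℕ} → List.length us < n →
  replace p n (elim (target l us)) ≡ elim (target l us)
replace-target p zero          us       us<n = refl
replace-target p (suc l)       []       us<n = refl
replace-target p (suc zero)    (u ∷ us) us<n = replace-≢ p (>⇒≢ us<n)
replace-target p (suc (suc l)) (u ∷ us) us<n =
  replace-target p (suc l) us (<-trans (n<1+n _) us<n)

-- Extends `jump` by `D` to an empty remainder, so that the clauses of `extract` for a last
-- instruction merge with the others into single equations.
jumpInto : ℕ → List (Instr A) → BTA A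
jumpInto l []       = D
jumpInto l (u ∷ us) = jump l u us

extract-basic : (a : A) (us : List (Instr A)) → extract (basic a) us ≡ a ∘ jumpInto 1 us
extract-basic a []       = refl
extract-basic a (u ∷ us) = refl

extract-+a : (a : A) (us : List (Instr A)) →
  extract (+ a) us ≡ jumpInto 1 us ⊴ a ⊵ jumpInto 2 us
extract-+a a []       = refl
extract-+a a (u ∷ us) = refl

extract--a : (a : A) (us : List (Instr A)) →
  extract (- a) us ≡ jumpInto 2 us ⊴ a ⊵ jumpInto 1 us
extract--a a []       = refl
extract--a a (u ∷ us) = refl

extract-# : (l : ℕ) (us : List (Instr A)) → extract {A = A} (# l) us ≡ jumpInto l us
extract-# l []       = refl
extract-# l (u ∷ us) = refl

jumpInto-zero : (us : List (Instr A)) → jumpInto 0 us ≡ D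
jumpInto-zero []       = refl
jumpInto-zero (u ∷ us) = refl

jumpInto-suc : (l : ℕ) (u : Instr A) (us : List (Instr A)) →
  jumpInto (suc (suc l)) (u ∷ us) ≡ jumpInto (suc l) us
jumpInto-suc l u []       = refl
jumpInto-suc l u (v ∷ vs) = refl

mutual
  -- The mutual recursion terminates because the references of `u` are resolved in `us` alone, and a
  -- variable found there leads to an instruction with a strictly shorter remainder.
  resolve-node : (u : Instr A) (us : List (Instr A)) → resolve us (elim (node u us)) ≡ extract u us
  resolve-node (basic a) us = trans (resolve-branch a 1 1 us) (sym (extract-basic a us))
  resolve-node (+ a)     us = trans (resolve-branch a 1 2 us) (sym (extract-+a a us))
  resolve-node (- a)     us = trans (resolve-branch a 2 1 us) (sym (extract--a a us))
  resolve-node (# l)     us = trans (resolve-target l us) (sym (extract-# l us))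
  resolve-node !         us = resolve-S us

  resolve-branch : (a : A) (k l : ℕ) (us : List (Instr A)) →
    resolve us (elim (target k us ⊴ a ⊵ target l us)) ≡ jumpInto k us ⊴ a ⊵ jumpInto l us
  resolve-branch a k l us =
    trans (resolve-⊴⊵ us _ a _) (cong₂ (_⊴ a ⊵_) (resolve-target k us) (resolve-target l us))

  resolve-target : (l : ℕ) (us : List (Instr A)) → resolve us (elim (target l us)) ≡ jumpInto l us
  resolve-target zero          us       = trans (resolve-D us) (sym (jumpInto-zero us))
  resolve-target (suc l)       []       = refl
  resolve-target (suc zero)    (u ∷ us) = resolve-var u us
  resolve-target (suc (suc l)) (u ∷ us) = begin
    resolve us (replace (elim (node u us)) (suc (List.length us)) (elim (target (suc l) us)))
      -- The first binding is for the variable of `u`, whose number exceeds every number in a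
      -- reference into `us`; jumping over `u` makes it vacuous.
      ≡⟨ cong (resolve us) (replace-target _ (suc l) us ≤-refl) ⟩
    resolve us (elim (target (suc l) us))
      ≡⟨ resolve-target (suc l) us ⟩
    jumpInto (suc l) us
      ≡⟨ jumpInto-suc l u us ⟨
    jumpInto (suc (suc l)) (u ∷ us) ∎
    where open ≡-Reasoning

  resolve-var : (u : Instr A) (us : List (Instr A)) →
    resolve (u ∷ us) (var (suc (List.length us))) ≡ extract u us
  resolve-var u us =
    trans (cong (resolve us) (replace-≡ _ (suc (List.length us)))) (resolve-node u us)

mutual
  -- `Closed` constrains only the result of `elim`. Since that result is an extracted thread,
  -- closedness of the compressed terms reduces to this.
  extract-closed : (u : Instr A) (us : List (Instr A)) (x : Var) → ¬ (x occursIn extract u us)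
  extract-closed (basic a) []       x (left ())
  extract-closed (basic a) []       x (right ())
  extract-closed (basic a) (v ∷ vs) x (left o)  = extract-closed v vs x o
  extract-closed (basic a) (v ∷ vs) x (right o) = extract-closed v vs x o
  extract-closed (+ a)     []       x (left ())
  extract-closed (+ a)     []       x (right ())
  extract-closed (+ a)     (v ∷ vs) x (left o)  = extract-closed v vs x o
  extract-closed (+ a)     (v ∷ vs) x (right o) = jump-closed 2 v vs x o
  extract-closed (- a)     []       x (left ())
  extract-closed (- a)     []       x (right ())
  extract-closed (- a)     (v ∷ vs) x (left o)  = jump-closed 2 v vs x o
  extract-closed (- a)     (v ∷ vs) x (right o) = extract-closed v vs x o
  extract-closed (# l)     (v ∷ vs) x o         = jump-closed l v vs x o

  jump-closed : (l : ℕ) (u : Instr A) (us : List (Instr A)) (x : Var) → ¬ (x occursIn jump l u us)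
  jump-closed (suc zero)    u us       x o = extract-closed u us x o
  jump-closed (suc (suc l)) u (v ∷ vs) x o = jump-closed (suc l) v vs x o

-- References are leaves: a thread shared by several instructions is pointed to, never copied. This
-- bounds the size of a node whatever follows it.
size-target : (l : ℕ) (us : List (Instr A)) → size (target l us) ≡ 1
size-target zero          us       = refl
size-target (suc l)       []       = refl
size-target (suc zero)    (u ∷ us) = refl
size-target (suc (suc l)) (u ∷ us) = size-target (suc l) us

size-branch : (a : A) (k l : ℕ) (us : List (Instr A)) → size (target k us ⊴ a ⊵ target l us) ≡ 3
size-branch a k l us = cong₂ (λ m n → m + n + 1) (size-target k us) (size-target l us)

size-node : (u : Instr A) (us : List (Instr A)) → size (node u us) ≤ 3
size-node (basic a) us = ≤-reflexive (size-branch a 1 1 us)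
size-node (+ a)     us = ≤-reflexive (size-branch a 1 2 us)
size-node (- a)     us = ≤-reflexive (size-branch a 2 1 us)
size-node (# l)     us = subst (_≤ 3) (sym (size-target l us)) (s≤s z≤n)
size-node !         us = s≤s z≤n

-- Stated for arbitrary `q` because `q` grows along the recursion, absorbing one binding at each
-- step.
size-bind : (us : List (Instr A)) (q : Term A) → size (bind us q) ≤ 4 * List.length us + size q
size-bind []       q = ≤-refl
size-bind (u ∷ us) q = begin
  size (bind us ([ node u us / _ ] q))    ≤⟨ size-bind us _ ⟩
  -- At most 3 for the node and 1 for the substitution constructor: the four units charged to `u`.
  4 * n + (size (node u us) + size q + 1) ≤⟨ +-monoʳ-≤ (4 * n) (+-monoˡ-≤ 1 (+-monoˡ-≤ (size q) (size-node u us))) ⟩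
  4 * n + (3 + size q + 1)                ≡⟨ regroup n (size q) ⟩
  4 * suc n + size q                      ∎
  where
  open ≤-Reasoning
  n = List.length us
  regroup : ∀ n s → 4 * n + (3 + s + 1) ≡ 4 * suc n + s
  regroup = solve 2 (λ n s → con 4 :* n :+ (con 3 :+ s :+ con 1) := con 4 :* (con 1 :+ n) :+ s) refl
    where open +-*-Solver

compress : InstrSeq A → Term A
-- The start term is the variable of the first instruction; its size is the summand 1 of the bound.
compress (u ∷ us) = bind (u ∷ us) (var (suc (List.length us)))

elim-compress : (P : InstrSeq A) → elim (compress P) ≡ ∣ P ∣
elim-compress (u ∷ us) = trans (elim-bind (u ∷ us) _) (resolve-var u us)

compress-closed : (P : InstrSeq A) → Closed (compress P)
compress-closed P@(u ∷ us) x o =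
  extract-closed u us x (subst (x occursIn_) (elim-compress P) o)

size-compress : (P : InstrSeq A) → size (compress P) ≤ 4 * length P + 1
size-compress (u ∷ us) = size-bind (u ∷ us) _

theoremA : {ℓ : Level} (A : Set ℓ) →
    Σ (InstrSeq A → ClosedTerm A) (λ ρ →
    (P : InstrSeq A) →
    (elim (proj₁ (ρ P)) ≡ ∣ P ∣) ×
    (size (proj₁ (ρ P)) ≤ 4 * length P + 1))
theoremA A = (λ P → compress P , compress-closed P) , λ P → elim-compress P , size-compress P
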